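{- For every integer $n\ge 2$, $R(c(nK_3),c(nK_3))=7n-2$.
   Context: $nK_3$ denotes $n$ pairwise vertex-disjoint triangles. $c(nK_3)$ (a connected triangle matching) denotes any connected graph containing $n$ pairwise vertex-disjoint triangles. $R(c(nK_3),c(nK_3))$ denotes the smallest positive integer $N$ such that in every coloring of the edges of the complete graph $K_N$ with two colors (red and blue), there is a color for which the graph formed by the edges of that color contains, as a subgraph, some connected graph containing $n$ pairwise vertex-disjoint triangles (equivalently, some connected component of one of the two color classes contains $n$ pairwise vertex-disjoint triangles). -}

module Defs where

open import Data.Fin using (Fin)
open import Data.Nat using (ℕ; _≤_)
open import Data.Product using (Σ; _×_; _,_)
open import Data.Sum using (_⊎_)
open import Function.Definitions using (Injective)
open import Relation.Binary.Definitions using (Symmetric; Irreflexive)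
open import Relation.Binary.Construct.Closure.ReflexiveTransitive using (Star)
open import Relation.Binary.PropositionalEquality
  using (_≡_; _≢_; refl; sym; trans; ≢-sym)

record Graph : Set₁ where
  field
    V      : Set
    _~_    : V → V → Set
    ~-sym  : Symmetric _~_
    ~-irr  : Irreflexive _≡_ _~_

open Graph public using (V)

-- Not necessarily induced: G has a subgraph isomorphic to H.
record _⊑_ (H G : Graph) : Set where
  private
    module H = Graph H
    module G = Graph G
  field
    map        : H.V → G.V
    injective  : Injective _≡_ _≡_ map
    preserves  : ∀ {u v} → u H.~ v → map u G.~ map v

Connected : Graph → Set
Connected G = V G × (∀ u v → Star (Graph._~_ G) u v)

K : ℕ → Graph
K N = record
  { V     = Fin N
  ; _~_   = _≢_
  ; ~-sym = ≢-sym
  ; ~-irr = λ u≡v u≢v → u≢v u≡v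
  }

_K₃ : ℕ → Graph
n K₃ = record
  { V     = Fin n × Fin 3
  ; _~_   = λ { (i , a) (j , b) → i ≡ j × a ≢ b }
  ; ~-sym = λ { (i≡j , a≢b) → sym i≡j , ≢-sym a≢b }
  ; ~-irr = λ { refl (_ , a≢a) → a≢a refl }
  }

Family : Set₁
Family = Graph → Set

-- No finiteness is asked of H: it is only used as a subgraph of some K N.
c[_K₃] : ℕ → Family
c[ n K₃] H = Connected H × (n K₃) ⊑ H

data Colour : Set where
  red blue : Colour

-- Values at non-adjacent pairs (in particular on the diagonal) are junk:
-- `class` only looks at edges of G.
record EdgeColouring (G : Graph) : Set where
  field
    colour      : V G → V G → Colour
    colour-sym  : ∀ u v → colour u v ≡ colour v u

class : {G : Graph} → EdgeColouring G → Colour → Graph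
class {G} χ k = record
  { V     = G.V
  ; _~_   = λ u v → u G.~ v × colour u v ≡ k
  ; ~-sym = λ { {u} {v} (e , eq) → G.~-sym e , trans (colour-sym v u) eq }
  ; ~-irr = λ { u≡v (e , _) → G.~-irr u≡v e }
  }
  where
    module G = Graph G
    open EdgeColouring χ

Contains : Graph → Family → Set₁
Contains G 𝓕 = Σ Graph λ H → 𝓕 H × H ⊑ G

_⟶[_,_] : ℕ → Family → Family → Set₁
N ⟶[ 𝓕 , 𝓖 ] = (χ : EdgeColouring (K N)) →
  Contains (class χ red) 𝓕 ⊎ Contains (class χ blue) 𝓖

-- R(𝓕, 𝓖) ≡ N, as a relation: N is the smallest positive integer with
-- N ⟶[ 𝓕 , 𝓖 ].
record R⟨_,_⟩≡_ (𝓕 𝓖 : Family) (N : ℕ) : Set₁ where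
  field
    positive : 1 ≤ N
    arrows   : N ⟶[ 𝓕 , 𝓖 ]
    least    : ∀ M → 1 ≤ M → M ⟶[ 𝓕 , 𝓖 ] → N ≤ M

{-# OPTIONS --safe #-}
module Submission where

-- Write k for one colour and k′ for the other. Two facts drive the upper bound.
--
-- (1) A set of at least 3n − 1 + t vertices, t ≤ n, contains t disjoint k′-edges or a connected
--     k-coloured nK₃. Otherwise take a maximum k′-matching, with m < t edges: its leftover R is a
--     k-clique, and by maximality every matching edge has an endpoint with at most one k′-neighbour
--     in R. Each such endpoint forms a k-triangle with two vertices of R, and the rest of R
--     supplies n − m further ones.
-- (2) 6n − 1 vertices contain a monochromatic nK₃ for n ≥ 2. Extracting triangles greedily, one
--     finds nK₃ or disjoint triangles of both colours; in the latter case some five of these six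
--     vertices carry a red and a blue triangle sharing a vertex, and the remaining 6(n − 1)
--     vertices contain (n − 1)K₃ greedily.
--
-- If both colours are connected, (2) suffices. Otherwise the vertices split as A ∪ B with only
-- k′-edges across, so k′ is connected. If both sides have at least n vertices, (1) gives
-- s + t = n disjoint k′-edges, s in A and t in B, each of which is completed to a k′-triangle by
-- an unmatched vertex of the other side. If B has fewer than n, A has at least 6n − 1: either A is
-- k-connected and (2) applies in it, or A splits and one recurses.
--
-- For the lower bound, colour 7n − 3 vertices in three blocks of sizes 3n − 1, 3n − 1, n − 1, red
-- inside the blocks and blue between them.

open import Defs
open import Data.Nat
open import Data.Nat.Properties
open import Relation.Binary.PropositionalEquality
  using (_≡_; _≢_; refl; sym; trans; cong; cong₂; subst)

-- Opened before the other overloadings of [] and _∷_ come into scope, on which `solve` blocks;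
-- abstract, because with-abstraction would otherwise normalise the solver's proofs.
module Arithmetic where

  open import Data.List using ([]; _∷_)
  open import Data.Nat.Tactic.RingSolver using (solve)

  abstract

    -- `c` is the slack of the inequality. Once it is given, each use reduces to a polynomial
    -- identity for the ring solver.
    linear : ∀ {a b p q} c → p ≤ q → a + q + c ≡ b + p → a ≤ b
    linear {a} {b} {p} {q} c p≤q eq =
      +-cancelʳ-≤ q a b (≤-trans (m≤m+n (a + q) c) (≤-trans (≤-reflexive eq) (+-monoʳ-≤ b p≤q)))

    majority : ∀ a b → a < 3 → 5 ≤ a + b → 3 ≤ b
    majority a b h₁ h₂ = linear 0 (+-mono-≤ h₁ h₂) (solve (a ∷ b ∷ []))

    packing⇒6≤ : ∀ p q l → 3 * (suc p + suc q) ≤ l → 6 ≤ l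
    packing⇒6≤ p q l h = linear (3 * (p + q)) h (solve (p ∷ q ∷ l ∷ []))

    drop-first : ∀ p q l → 3 * (suc p + suc q) ≤ 3 + l → 3 * (p + suc q) ≤ l
    drop-first p q l h = linear 0 h (solve (p ∷ q ∷ l ∷ []))

    drop-second : ∀ p q l → 3 * (suc p + suc q) ≤ 3 + l → 3 * (suc p + q) ≤ l
    drop-second p q l h = linear 0 h (solve (p ∷ q ∷ l ∷ []))

    reserve⇒6≤ : ∀ m l → 3 * suc m + 3 ≤ l → 6 ≤ l
    reserve⇒6≤ m l h = linear (3 * m) h (solve (m ∷ l ∷ []))

    drop-triangle : ∀ m l → 3 * suc m + 3 ≤ 3 + l → 3 * m + 3 ≤ l
    drop-triangle m l h = linear 0 h (solve (m ∷ l ∷ []))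

    6≤ : ∀ m l → 6 * suc (suc m) ≤ suc l → 6 ≤ l
    6≤ m l h = linear (5 + 6 * m) h (solve (m ∷ l ∷ []))

    collect : ∀ m l → 6 * suc (suc m) ≤ 4 + l → 3 * suc m + 3 ≤ l
    collect m l h = linear (2 + 3 * m) h (solve (m ∷ l ∷ []))

    recurse : ∀ m l → 6 * suc m ≤ 6 + l → 3 * (m + m) ≤ l
    recurse m l h = linear 0 h (solve (m ∷ l ∷ []))

    clique-large : ∀ t j l → 3 * (t + j) + suc t ≤ suc (2 * t + l) → 3 * j + 2 * t ≤ l
    clique-large t j l h = linear 0 h (solve (t ∷ j ∷ l ∷ []))

    2≤clique : ∀ t j l → 3 * suc j + 2 * t ≤ l → 2 ≤ l
    2≤clique t j l h = linear (1 + 3 * j + 2 * t) h (solve (t ∷ j ∷ l ∷ []))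

    drop₃ : ∀ j l → 3 * suc j ≤ 3 + l → 3 * j ≤ l
    drop₃ j l h = linear 0 h (solve (j ∷ l ∷ []))

    drop₂ : ∀ j u l → 3 * j + 2 * suc u ≤ 3 + l → 3 * j + 2 * u ≤ suc l
    drop₂ j u l h = linear 0 h (solve (j ∷ u ∷ l ∷ []))

    3≤clique : ∀ j u l → 3 * suc j + 2 * suc u ≤ l → 3 ≤ l
    3≤clique j u l h = linear (2 + 3 * j + 2 * u) h (solve (j ∷ u ∷ l ∷ []))

    -- a and b are the sizes of the two sides of a cut, of total size at least 7n − 2.
    other-side : ∀ n a b → 7 * n ≤ 2 + (a + b) → suc b < 3 * n + n → 3 * n ≤ suc a
    other-side n a b h₁ h₂ = linear 1 (+-mono-≤ h₁ h₂) (solve (n ∷ a ∷ b ∷ []))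

    other-matching : ∀ s t a b → 7 * (s + t) ≤ 2 + (a + b) → suc a ≤ 3 * (s + t) + s →
      3 * (s + t) + t ≤ suc b
    other-matching s t a b h₁ h₂ = linear 0 (+-mono-≤ h₁ h₂) (solve (s ∷ t ∷ a ∷ b ∷ []))

    matching-leftover : ∀ s t r → 1 ≤ s + t → 3 * (s + t) + s ≤ suc (2 * s + r) → t ≤ r
    matching-leftover s t r h₁ h₂ = linear (s + t) (+-mono-≤ h₁ h₂) (solve (s ∷ t ∷ r ∷ []))

    small-side : ∀ n a b → 7 * n ≤ 2 + (a + b) → b < n → 6 * n ≤ suc a
    small-side n a b h₁ h₂ = linear 0 (+-mono-≤ h₁ h₂) (solve (n ∷ a ∷ b ∷ []))

    large-part : ∀ n a b → 6 * suc n ≤ suc (a + b) → a < suc n → suc n ≤ b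
    large-part n a b h₁ h₂ = linear (4 + 4 * n) (+-mono-≤ h₁ h₂) (solve (n ∷ a ∷ b ∷ []))

    nonempty : ∀ n l → 6 * suc n ≤ suc l → 1 ≤ l
    nonempty n l h = linear (4 + 6 * n) h (solve (n ∷ l ∷ []))

    six≤seven : ∀ n l → 2 ≤ n → 7 * n ≤ 2 + l → 6 * n ≤ suc l
    six≤seven n l h₁ h₂ = linear 1 (+-mono-≤ h₁ h₂) (solve (n ∷ l ∷ []))

    2<7n : ∀ m → 2 < 7 * suc m
    2<7n m = linear (4 + 7 * m) (z≤n {0}) (solve (m ∷ []))

    three-blocks : ∀ m M → M < 7 * suc m ∸ 2 → M ≤ 2 + 3 * m + (2 + 3 * m) + m
    three-blocks m M h =
      linear 0 (m≤o∸n⇒m+n≤o (suc M) (<⇒≤ (2<7n m)) h) (solve (m ∷ M ∷ []))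

    large-block : ∀ m s → s ≤ 2 + 3 * m → suc m * 3 ≤ s → 1 ≤ 0
    large-block m s h₁ h₂ = linear 0 (+-mono-≤ h₁ h₂) (solve (m ∷ s ∷ []))

    m≤2+3m : ∀ m → m ≤ 2 + 3 * m
    m≤2+3m m = linear (2 + 2 * m) (z≤n {0}) (solve (m ∷ []))

open Arithmetic

open import Data.Fin using (Fin; zero; suc; toℕ; fromℕ<; remQuot; combine)
open import Data.Fin.Patterns using (0F; 1F; 2F)
import Data.Fin.Properties as Fin
open import Data.List using (List; []; _∷_; _++_; [_]; length; lookup; allFin)
open import Data.List.Membership.Propositional using (_∈_)
open import Data.List.Membership.Propositional.Properties using (∈-++⁺ˡ; ∈-++⁺ʳ; ∈-++⁻; ∈-lookup)
open import Data.List.Properties using (length-++; ++-assoc; length-tabulate)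
open import Data.List.Relation.Binary.Permutation.Propositional
  using (_↭_; prep; swap; ↭-refl; ↭-sym; ↭-trans; ↭-reflexive; ↭⇒↭ₛ)
open import Data.List.Relation.Binary.Permutation.Propositional.Properties
  using (∈-resp-↭; All-resp-↭; ↭-length; ++⁺; ++⁺ˡ; ++⁺ʳ; ++-comm; shift; shifts;
         ++-commutativeMonoid; ++-identityʳ)
import Data.List.Relation.Binary.Permutation.Setoid.Properties as Permutation
open import Data.List.Relation.Unary.All as All using (All; []; _∷_)
import Data.List.Relation.Unary.All.Properties as All
open import Data.List.Relation.Unary.AllPairs using (AllPairs; []; _∷_)
open import Data.List.Relation.Unary.Any using (here; there; index)
open import Data.List.Relation.Unary.Any.Properties using (lookup-index)
open import Data.List.Relation.Unary.Unique.Propositional using (Unique)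
open import Data.List.Relation.Unary.Unique.Propositional.Properties using (allFin⁺)
open import Data.Product using (Σ; ∃; ∃₂; _×_; _,_; proj₁; proj₂; map₂; uncurry)
open import Data.Sum using (_⊎_; inj₁; inj₂; [_,_]′)
open import Function using (_∘_; id)
open import Function.Definitions using (Injective)
open import Relation.Binary.Construct.Closure.ReflexiveTransitive
  using (Star; ε; _◅_; gmap; reverse)
open import Relation.Binary.PropositionalEquality.Properties using (setoid)
open import Relation.Nullary using (¬_; yes; no; contradiction)

-- Decomposing lists up to permutation.

module _ {A : Set} where

  open import Algebra.Solver.CommutativeMonoid (++-commutativeMonoid {A = A})
    using (_⊜_) renaming (solve to permute; _⊕_ to _∙_)

  private variable
    P Q : A → Set
    R S : A → A → Set

  rotate₃ : ∀ (x y z : A) xs → x ∷ y ∷ z ∷ xs ↭ y ∷ z ∷ x ∷ xs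
  rotate₃ x y z xs =
    permute 4 (λ x y z xs → x ∙ (y ∙ (z ∙ xs)) ⊜ y ∙ (z ∙ (x ∙ xs))) ↭-refl [ x ] [ y ] [ z ] xs

  splitAll : (∀ x → P x ⊎ Q x) → ∀ xs →
    ∃₂ λ ys zs → All P ys × All Q zs × ys ++ zs ↭ xs
  splitAll dec []       = [] , [] , [] , [] , ↭-refl
  splitAll dec (x ∷ xs) with dec x | splitAll dec xs
  ... | inj₁ px | ys , zs , pys , qzs , σ = x ∷ ys , zs , px ∷ pys , qzs , prep x σ
  ... | inj₂ qx | ys , zs , pys , qzs , σ =
    ys , x ∷ zs , pys , qx ∷ qzs , ↭-trans (shift x ys zs) (prep x σ)

  all-or-one : (∀ x → P x ⊎ Q x) → ∀ xs →
    All P xs ⊎ ∃₂ λ y ys → Q y × y ∷ ys ↭ xs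
  all-or-one dec []       = inj₁ []
  all-or-one dec (x ∷ xs) with dec x | all-or-one dec xs
  ... | inj₂ qx | _                       = inj₂ (x , xs , qx , ↭-refl)
  ... | inj₁ px | inj₁ pxs                = inj₁ (px ∷ pxs)
  ... | inj₁ px | inj₂ (y , ys , qy , σ) =
    inj₂ (y , x ∷ ys , qy , ↭-trans (swap y x ↭-refl) (prep x σ))

  -- For edges of opposite colours this is the choice between a clique and an edge that extends a
  -- matching. `good-or-two` applies it to relations depending on a fixed vertex.
  allPairs-or-one : (∀ x y → R x y ⊎ S x y) → ∀ xs →
    AllPairs R xs ⊎ ∃₂ λ y z → S y z × ∃ λ ys → y ∷ z ∷ ys ↭ xs
  allPairs-or-one dec []       = inj₁ []
  allPairs-or-one dec (x ∷ xs) with all-or-one (dec x) xs | allPairs-or-one dec xs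
  ... | inj₂ (y , ys , sxy , σ) | _          = inj₂ (x , y , sxy , ys , prep x σ)
  ... | inj₁ rx                 | inj₁ rxs   = inj₁ (rx ∷ rxs)
  ... | inj₁ rx                 | inj₂ (y , z , syz , ys , σ) =
    inj₂ (y , z , syz , x ∷ ys , ↭-trans (↭-sym (rotate₃ x y z ys)) (prep x σ))

opp : Colour → Colour
opp red  = blue
opp blue = red

same-or-opp : ∀ k l → l ≡ k ⊎ l ≡ opp k
same-or-opp red  red  = inj₁ refl
same-or-opp red  blue = inj₂ refl
same-or-opp blue red  = inj₂ refl
same-or-opp blue blue = inj₁ refl

-- Two-coloured edges, triangles and greedy packings.

module Colouring {V : Set} (c : V → V → Colour) (c-sym : ∀ u v → c u v ≡ c v u) where

  open import Algebra.Solver.CommutativeMonoid (++-commutativeMonoid {A = V})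
    using (_⊜_) renaming (solve to permute; _⊕_ to _∙_)

  Edge : Colour → V → V → Set
  Edge k x y = c x y ≡ k

  private variable
    k l : Colour
    m n s t : ℕ
    u x y z : V
    xs ys zs A B R S : List V

  edge? : ∀ k x y → Edge k x y ⊎ Edge (opp k) x y
  edge? k x y = same-or-opp k (c x y)

  edge-sym : Edge k x y → Edge k y x
  edge-sym {x = x} {y} e = trans (c-sym y x) e

  Triangle : Colour → V → V → V → Set
  Triangle k x y z = Edge k x y × Edge k x z × Edge k y z

  -- Distinctness is not part of packings or matchings: it comes from the uniqueness of the
  -- ambient list, which perm and the leftovers preserve.
  data Packing (k : Colour) : ℕ → List V → Set where
    []       : Packing k 0 xs
    triangle : Triangle k x y z → Packing k m xs → Packing k (suc m) (x ∷ y ∷ z ∷ xs)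
    perm     : xs ↭ ys → Packing k m xs → Packing k m ys

  packing-++ʳ : ∀ ys → Packing k m xs → Packing k m (xs ++ ys)
  packing-++ʳ ys []             = []
  packing-++ʳ ys (triangle t p) = triangle t (packing-++ʳ ys p)
  packing-++ʳ ys (perm σ p)     = perm (++⁺ʳ ys σ) (packing-++ʳ ys p)

  packing-++ : Packing k m xs → Packing k n ys → Packing k (m + n) (xs ++ ys)
  packing-++ {xs = xs} {ys = ys} [] q = perm (++-comm ys xs) (packing-++ʳ xs q)
  packing-++ (triangle t p) q = triangle t (packing-++ p q)
  packing-++ (perm σ p)     q = perm (++⁺ʳ _ σ) (packing-++ p q)

  HasTriangle : Colour → List V → Set
  HasTriangle k xs = ∃ λ x → ∃ λ y → ∃ λ z → ∃ λ ws → Triangle k x y z × x ∷ y ∷ z ∷ ws ↭ xs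

  hasTriangle-⊆ : ∀ ys → xs ++ ys ↭ zs → HasTriangle k xs → HasTriangle k zs
  hasTriangle-⊆ ys σ (x , y , z , ws , t , τ) =
    x , y , z , ws ++ ys , t , ↭-trans (++⁺ʳ ys τ) σ

  -- Among three neighbours, an edge of colour `k` closes a triangle with `v`; if there is none, the
  -- three form a triangle of the other colour.
  star-triangle : ∀ v → 3 ≤ length xs → All (Edge k v) xs → ∃ λ l → HasTriangle l (v ∷ xs)
  star-triangle {x ∷ y ∷ z ∷ xs} {k} v _ (ex ∷ ey ∷ ez ∷ _)
    with edge? k x y | edge? k x z | edge? k y z
  ... | inj₁ exy | _        | _        = k , v , x , y , z ∷ xs , (ex , ey , exy) , ↭-refl
  ... | inj₂ _   | inj₁ exz | _        =
    k , v , x , z , y ∷ xs , (ex , ez , exz) , prep v (prep x (swap z y ↭-refl))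
  ... | inj₂ _   | inj₂ _   | inj₁ eyz =
    k , v , y , z , x ∷ xs , (ey , ez , eyz) , prep v (↭-sym (rotate₃ x y z xs))
  ... | inj₂ exy | inj₂ exz | inj₂ eyz =
    opp k , x , y , z , v ∷ xs , (exy , exz , eyz) ,
    permute 5 (λ v x y z xs → x ∙ (y ∙ (z ∙ (v ∙ xs))) ⊜ v ∙ (x ∙ (y ∙ (z ∙ xs)))) ↭-refl
      [ v ] [ x ] [ y ] [ z ] xs
  star-triangle {_ ∷ []} _ (s≤s ())
  star-triangle {_ ∷ _ ∷ []} _ (s≤s (s≤s ()))

  ramsey : ∀ xs → 6 ≤ length xs → ∃ λ k → HasTriangle k xs
  ramsey (v ∷ xs) (s≤s h) with splitAll (edge? red v) xs
  ... | ys , zs , reds , blues , σ with 3 ≤? length ys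
  ... | yes p = map₂ (hasTriangle-⊆ zs (prep v σ)) (star-triangle v p reds)
  ... | no ¬p = map₂ (hasTriangle-⊆ ys (prep v (↭-trans (++-comm zs ys) σ)))
    (star-triangle v q blues)
    where
    q : 3 ≤ length zs
    q = majority (length ys) (length zs) (≰⇒> ¬p)
      (subst (5 ≤_) (trans (sym (↭-length σ)) (length-++ ys)) h)

  -- While both targets are positive at least six vertices remain, and each triangle found lowers
  -- one target by one.
  packing : ∀ p q xs → 3 * (p + q) ≤ length xs → Packing red p xs ⊎ Packing blue q xs
  packing zero    q       xs h = inj₁ []
  packing (suc p) zero    xs h = inj₂ []
  packing (suc p) (suc q) xs h with ramsey xs (packing⇒6≤ p q _ h)
  ... | red , x , y , z , ws , t , σ
    with packing p (suc q) ws (drop-first p q _ (subst (_ ≤_) (sym (↭-length σ)) h))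
  ...   | inj₁ P = inj₁ (perm σ (triangle t P))
  ...   | inj₂ P = inj₂ (perm (↭-trans (++-comm ws (x ∷ y ∷ z ∷ [])) σ) (packing-++ʳ _ P))
  packing (suc p) (suc q) xs h | blue , x , y , z , ws , t , σ
    with packing (suc p) q ws (drop-second p q _ (subst (_ ≤_) (sym (↭-length σ)) h))
  ...   | inj₂ P = inj₂ (perm σ (triangle t P))
  ...   | inj₁ P = inj₁ (perm (↭-trans (++-comm ws (x ∷ y ∷ z ∷ [])) σ) (packing-++ʳ _ P))

  -- The three spare vertices keep six available up to the last triangle that is sought.
  packing-or-triangle : ∀ k m xs → 3 * m + 3 ≤ length xs → Packing k m xs ⊎ HasTriangle (opp k) xs
  packing-or-triangle k zero    xs h = inj₁ []
  packing-or-triangle k (suc m) xs h with ramsey xs (reserve⇒6≤ m _ h)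
  ... | l , T@(x , y , z , ws , t , σ) with same-or-opp k l
  ... | inj₂ refl = inj₂ T
  ... | inj₁ refl
    with packing-or-triangle k m ws (drop-triangle m _ (subst (_ ≤_) (sym (↭-length σ)) h))
  ...   | inj₁ P = inj₁ (perm σ (triangle t P))
  ...   | inj₂ T′ = inj₂ (hasTriangle-⊆ (x ∷ y ∷ z ∷ []) (↭-trans (++-comm ws _) σ) T′)

  -- Triangles of opposite colours and monochromatic packings.

  Bowtie : Colour → List V → Set
  Bowtie k xs = ∃ λ x → ∃ λ p → ∃ λ q → ∃ λ r → ∃ λ s → ∃ λ ws →
    Triangle k x p q × Triangle (opp k) x r s × x ∷ p ∷ q ∷ r ∷ s ∷ ws ↭ xs

  -- If `da` and `db` have colour `k`, then `dab` meets `def` in `d`. Otherwise, if `e` sends an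
  -- edge of colour `opp k` to `a` or to `b`, that vertex forms with `d` and `e` a triangle meeting
  -- `abc`; if not, `eab` has colour `k` and meets `def` in `e`.
  triangles-bowtie′ : ∀ {a b c d e f} → Triangle k a b c → Triangle (opp k) d e f →
    l ≡ k ⊎ l ≡ opp k → Edge l d a → Edge l d b → Bowtie k (a ∷ b ∷ c ∷ d ∷ e ∷ f ∷ [])
  triangles-bowtie′ {a = a} {b} {c} {d} {e} {f} (ab , ac , bc) (de , df , ef) (inj₁ refl) da db =
    d , a , b , e , f , c ∷ [] , (da , db , ab) , (de , df , ef) ,
    permute 6 (λ a b c d e f → d ∙ (a ∙ (b ∙ (e ∙ (f ∙ c)))) ⊜ a ∙ (b ∙ (c ∙ (d ∙ (e ∙ f)))))
      ↭-refl [ a ] [ b ] [ c ] [ d ] [ e ] [ f ]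
  triangles-bowtie′ {k} {a = a} {b} {c} {d} {e} {f} (ab , ac , bc) (de , df , ef) (inj₂ refl) da db
    with edge? k e a | edge? k e b
  ... | inj₂ ea | _       =
    a , b , c , d , e , f ∷ [] , (ab , ac , bc) , (edge-sym da , edge-sym ea , de) , ↭-refl
  ... | inj₁ ea | inj₂ eb =
    b , a , c , d , e , f ∷ [] , (edge-sym ab , bc , ac) , (edge-sym db , edge-sym eb , de) ,
    swap b a ↭-refl
  ... | inj₁ ea | inj₁ eb =
    e , a , b , d , f , c ∷ [] , (ea , eb , ab) , (edge-sym de , ef , df) ,
    permute 6 (λ a b c d e f → e ∙ (a ∙ (b ∙ (d ∙ (f ∙ c)))) ⊜ a ∙ (b ∙ (c ∙ (d ∙ (e ∙ f)))))
      ↭-refl [ a ] [ b ] [ c ] [ d ] [ e ] [ f ]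

  bowtie-resp-↭ : xs ↭ ys → Bowtie k xs → Bowtie k ys
  bowtie-resp-↭ σ (x , p , q , r , s , ws , t , t′ , τ) =
    x , p , q , r , s , ws , t , t′ , ↭-trans τ σ

  -- Two of the three edges from `d` to the first triangle share a colour; reordering that triangle
  -- makes them the first two.
  triangles-bowtie : ∀ {a b c d e f} → Triangle k a b c → Triangle (opp k) d e f →
    Bowtie k (a ∷ b ∷ c ∷ d ∷ e ∷ f ∷ [])
  triangles-bowtie {k} {a} {b} {c} {d} t@(ab , ac , bc) t′ with edge? k d a | edge? k d b | edge? k d c
  ... | inj₁ da | inj₁ db | _       = triangles-bowtie′ t t′ (inj₁ refl) da db
  ... | inj₂ da | inj₂ db | _       = triangles-bowtie′ t t′ (inj₂ refl) da db
  ... | inj₁ da | inj₂ db | inj₁ dc = bowtie-resp-↭ (prep a (swap c b ↭-refl))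
    (triangles-bowtie′ (ac , ab , edge-sym bc) t′ (inj₁ refl) da dc)
  ... | inj₂ da | inj₁ db | inj₂ dc = bowtie-resp-↭ (prep a (swap c b ↭-refl))
    (triangles-bowtie′ (ac , ab , edge-sym bc) t′ (inj₂ refl) da dc)
  ... | inj₂ da | inj₁ db | inj₁ dc = bowtie-resp-↭ (↭-sym (rotate₃ a b c _))
    (triangles-bowtie′ (bc , edge-sym ab , edge-sym ac) t′ (inj₁ refl) db dc)
  ... | inj₁ da | inj₂ db | inj₂ dc = bowtie-resp-↭ (↭-sym (rotate₃ a b c _))
    (triangles-bowtie′ (bc , edge-sym ab , edge-sym ac) t′ (inj₂ refl) db dc)

  mono-packing : ∀ n xs → 2 ≤ n → 6 * n ≤ suc (length xs) → ∃ λ k → Packing k n xs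
  mono-packing (suc zero) xs (s≤s ()) _
  mono-packing n@(suc m@(suc m′)) xs _ h with ramsey xs (6≤ m′ _ h)
  ... | k , a , b , d , ws , t , σ
    with packing-or-triangle k m ws (collect m′ _ (subst (λ l → 6 * n ≤ suc l) (sym (↭-length σ)) h))
  ... | inj₁ P = k , perm σ (triangle t P)
  ... | inj₂ (d′ , e , f , us , t′ , σ′) with triangles-bowtie t t′
  ... | x , p , q , r , s , vs , tk , to , τ = result
    where
    whole : x ∷ p ∷ q ∷ r ∷ s ∷ vs ++ us ↭ xs
    whole = ↭-trans (++⁺ʳ us τ) (↭-trans (prep a (prep b (prep d σ′))) σ)


    rest : ∃ λ l → Packing l m (vs ++ us)
    -- The bowtie covers five vertices and the hypothesis falls one short of 6n, so exactly the 6m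
    -- vertices needed for `m` triangles in some colour are guaranteed. Either half of the bowtie
    -- can then be added.
    rest with packing m m (vs ++ us)
      (recurse m _ (subst (λ l → 6 * n ≤ suc l) (sym (↭-length whole)) h))
    ... | inj₁ P = red , P
    ... | inj₂ P = blue , P

    result : ∃ λ l → Packing l (suc m) xs
    result with rest
    ... | l , P with same-or-opp k l
    ... | inj₁ refl = l ,
      perm (↭-trans (prep x (prep p (prep q (++-comm (vs ++ us) (r ∷ s ∷ []))))) whole)
        (triangle tk (packing-++ʳ _ P))
    ... | inj₂ refl = l , perm (↭-trans
      (permute 6 (λ x p q r s ws → x ∙ (r ∙ (s ∙ (ws ∙ (p ∙ q)))) ⊜ x ∙ (p ∙ (q ∙ (r ∙ (s ∙ ws)))))
        ↭-refl [ x ] [ p ] [ q ] [ r ] [ s ] (vs ++ us)) whole)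
      (triangle to (packing-++ʳ (p ∷ q ∷ []) P))

  -- Matchings, cliques and the exchange argument.

  data Matching (k : Colour) : ℕ → List V → List V → Set where
    none : R ↭ xs → Matching k 0 R xs
    edge : Edge k x y → Matching k m R xs → x ∷ y ∷ xs ↭ ys → Matching k (suc m) R ys

  matching-resp-↭ : xs ↭ ys → Matching k m R xs → Matching k m R ys
  matching-resp-↭ σ (none τ)     = none (↭-trans τ σ)
  matching-resp-↭ σ (edge e M τ) = edge e M (↭-trans τ σ)

  matching-++ˡ : ∀ zs → Matching k m R xs → Matching k m (zs ++ R) (zs ++ xs)
  matching-++ˡ zs (none σ)     = none (++⁺ˡ zs σ)
  matching-++ˡ zs (edge {x = x} {y} e M σ) =
    edge e (matching-++ˡ zs M) (↭-trans (shifts (x ∷ y ∷ []) zs) (++⁺ˡ zs σ))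

  -- Matchings grow by matching their leftover, which is why the leftover is an index of `Matching`.
  matching-trans : Matching k m R xs → Matching k n S R → Matching k (m + n) S xs
  matching-trans (none σ)     M′ = matching-resp-↭ σ M′
  matching-trans (edge e M σ) M′ = edge e (matching-trans M M′) σ

  matching-length : Matching k m R xs → length xs ≡ 2 * m + length R
  matching-length (none σ) = sym (↭-length σ)
  matching-length {m = suc m} {R} (edge e M σ) = trans (sym (↭-length σ))
    (trans (cong (2 +_) (matching-length M)) (cong (_+ length R) (sym (*-suc 2 m))))

  Clique : Colour → List V → Set
  Clique k = AllPairs (Edge k)

  -- At most one edge from u to R avoids colour k.
  Good : Colour → List V → V → Set
  Good k R u = AllPairs (λ p q → Edge k u p ⊎ Edge k u q) R

  good-or-two : ∀ k R u → Good k R u ⊎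
    ∃₂ λ p q → (Edge (opp k) u p × Edge (opp k) u q) × ∃ λ S → p ∷ q ∷ S ↭ R
  good-or-two k R u = allPairs-or-one dec R
    where
    dec : ∀ p q → (Edge k u p ⊎ Edge k u q) ⊎ (Edge (opp k) u p × Edge (opp k) u q)
    dec p q with edge? k u p | edge? k u q
    ... | inj₁ ep | _       = inj₁ (inj₁ ep)
    ... | inj₂ _  | inj₁ eq = inj₁ (inj₂ eq)
    ... | inj₂ ep | inj₂ eq = inj₂ (ep , eq)

  all⇒good : All (Edge k u) R → Good k R u
  all⇒good []       = []
  all⇒good (e ∷ es) = All.map (λ _ → inj₁ e) es ∷ all⇒good es

  -- If `x` is not good, it has two neighbours `p`, `q` in colour `opp k`. Any such neighbour of `y`
  -- in `R` differs from one of them, which leaves two disjoint edges; if `y` has none, it is good.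
  good-endpoint : ∀ k x y R → Good k R x ⊎ Good k R y ⊎ ∃ λ S → Matching (opp k) 2 S (x ∷ y ∷ R)
  good-endpoint k x y R with good-or-two k R x
  ... | inj₁ good = inj₁ good
  ... | inj₂ (p , q , (xp , xq) , S , σ) with edge? k y p | edge? k y q | all-or-one (edge? k y) S
  ... | inj₂ yp | _       | _ = inj₂ (inj₂ (S , edge xq (edge yp (none ↭-refl) ↭-refl)
    (↭-trans (permute 5 (λ x y p q S → x ∙ (q ∙ (y ∙ (p ∙ S))) ⊜ x ∙ (y ∙ (p ∙ (q ∙ S))))
      ↭-refl [ x ] [ y ] [ p ] [ q ] S) (prep x (prep y σ)))))
  ... | inj₁ _  | inj₂ yq | _ = inj₂ (inj₂ (S , edge xp (edge yq (none ↭-refl) ↭-refl)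
    (prep x (↭-trans (swap p y ↭-refl) (prep y σ)))))
  ... | inj₁ yp | inj₁ yq | inj₁ yS = inj₂ (inj₁ (all⇒good (All-resp-↭ σ (yp ∷ yq ∷ yS))))
  ... | inj₁ _  | inj₁ _  | inj₂ (w , S′ , yw , τ) = inj₂ (inj₂ (q ∷ S′ ,
    edge xp (edge yw (none ↭-refl) ↭-refl)
    (prep x (↭-trans (swap p y (swap w q ↭-refl)) (prep y (↭-trans (prep p (prep q τ)) σ))))))

  -- An edge without a good endpoint is exchanged for two edges. Otherwise `us` takes one good
  -- endpoint of each edge and `ws` the other.
  augment-or-good : Matching (opp k) m R xs →
    (∃ λ S → Matching (opp k) (suc m) S xs) ⊎
    (∃₂ λ us ws → length us ≡ m × All (Good k R) us × (us ++ R) ++ ws ↭ xs)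
  augment-or-good {R = R} (none σ) = inj₂ ([] , [] , refl , [] , ↭-trans (++-identityʳ R) σ)
  augment-or-good {k} {suc m} {R} {zs} (edge {x = x} {y} e M σ) with augment-or-good M
  ... | inj₁ (S , M′) = inj₁ (S , edge e M′ σ)
  ... | inj₂ (us , ws , len , good , τ) with good-endpoint k x y R
  ... | inj₁ gx = inj₂ (x ∷ us , y ∷ ws , cong suc len , gx ∷ good ,
    ↭-trans (prep x (↭-trans (shift y (us ++ R) ws) (prep y τ))) σ)
  ... | inj₂ (inj₁ gy) = inj₂ (y ∷ us , x ∷ ws , cong suc len , gy ∷ good ,
    ↭-trans (prep y (↭-trans (shift x (us ++ R) ws) (prep x τ))) (↭-trans (swap y x ↭-refl) σ))
  ... | inj₂ (inj₂ (S , M₂)) = inj₁ (S , subst (λ i → Matching (opp k) i S zs) (+-comm m 2)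
    (matching-resp-↭ σ (matching-trans (matching-++ˡ (x ∷ y ∷ []) M) M₂)))

  clique-packing : ∀ j → Clique k R → 3 * j ≤ length R → Packing k j R
  clique-packing zero _ _ = []
  clique-packing {R = p ∷ q ∷ r ∷ R} (suc j) ((pq ∷ pr ∷ _) ∷ (qr ∷ _) ∷ _ ∷ K) h =
    triangle (pq , pr , qr) (clique-packing j K (drop₃ j (length R) h))
  clique-packing (suc j) [] h with () ← ≤-trans (*-monoʳ-≤ 3 (s≤s (z≤n {j}))) h
  clique-packing (suc j) (_ ∷ []) h with s≤s () ← ≤-trans (*-monoʳ-≤ 3 (s≤s (z≤n {j}))) h
  clique-packing (suc j) (_ ∷ _ ∷ []) h with s≤s (s≤s ()) ← ≤-trans (*-monoʳ-≤ 3 (s≤s (z≤n {j}))) h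

  -- Each vertex of us takes two of the first three vertices of R.
  good-packing : ∀ j us R → Clique k R → All (Good k R) us →
    3 * suc j + 2 * length us ≤ length R → Packing k (length us + suc j) (us ++ R)
  good-packing j []       R K [] h = clique-packing (suc j) K (≤-trans (m≤m+n _ 0) h)
  -- The part `3 * suc j` of the bound guarantees three vertices in `R` even for the last vertex of
  -- `us`.
  good-packing j (u ∷ us) [] K gs h with () ← 3≤clique j (length us) 0 h
  good-packing j (u ∷ us) (_ ∷ []) K gs h with s≤s () ← 3≤clique j (length us) 1 h
  good-packing j (u ∷ us) (_ ∷ _ ∷ []) K gs h with s≤s (s≤s ()) ← 3≤clique j (length us) 2 h
  good-packing {k} j (u ∷ us) (p ∷ q ∷ r ∷ R) ((pq ∷ pr ∷ pR) ∷ (qr ∷ qR) ∷ rR ∷ K) (gu ∷ gs) h =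
    choose gu
    where
    Goal : Set
    Goal = Packing k (suc (length us + suc j)) (u ∷ us ++ p ∷ q ∷ r ∷ R)

    h′ : 3 * suc j + 2 * length us ≤ suc (length R)
    h′ = drop₂ (suc j) (length us) (length R) h

    dropPQ : ∀ {v} → Good k (p ∷ q ∷ r ∷ R) v → Good k (r ∷ R) v
    dropPQ (_ ∷ _ ∷ g) = g

    dropPR : ∀ {v} → Good k (p ∷ q ∷ r ∷ R) v → Good k (q ∷ R) v
    dropPR (_ ∷ (_ ∷ gq) ∷ _ ∷ g) = gq ∷ g

    dropQR : ∀ {v} → Good k (p ∷ q ∷ r ∷ R) v → Good k (p ∷ R) v
    dropQR ((_ ∷ _ ∷ gp) ∷ _ ∷ _ ∷ g) = gp ∷ g

    usePQ : Edge k u p → Edge k u q → Goal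
    usePQ up uq = perm (prep u (shifts (p ∷ q ∷ []) us))
      (triangle (up , uq , pq) (good-packing j us (r ∷ R) (rR ∷ K) (All.map dropPQ gs) h′))

    usePR : Edge k u p → Edge k u r → Goal
    usePR up ur = perm
      (prep u (↭-trans (shifts (p ∷ r ∷ []) us) (++⁺ˡ us (prep p (swap r q ↭-refl)))))
      (triangle (up , ur , pr) (good-packing j us (q ∷ R) (qR ∷ K) (All.map dropPR gs) h′))

    useQR : Edge k u q → Edge k u r → Goal
    useQR uq ur = perm
      (prep u (↭-trans (shifts (q ∷ r ∷ []) us) (++⁺ˡ us (↭-sym (rotate₃ p q r R)))))
      (triangle (uq , ur , qr) (good-packing j us (p ∷ R) (pR ∷ K) (All.map dropQR gs) h′))

    choose : Good k (p ∷ q ∷ r ∷ R) u → Goal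
    -- At most one of `p`, `q`, `r` is missed by `u`, so two of them complete a triangle with `u`.
    choose ((inj₁ up ∷ inj₁ up′ ∷ _) ∷ (inj₁ uq ∷ _) ∷ _) = usePQ up uq
    choose ((inj₁ up ∷ inj₁ up′ ∷ _) ∷ (inj₂ ur ∷ _) ∷ _) = usePR up ur
    choose ((inj₁ up ∷ inj₂ ur ∷ _) ∷ _) = usePR up ur
    choose ((inj₂ uq ∷ inj₁ up ∷ _) ∷ _) = usePQ up uq
    choose ((inj₂ uq ∷ inj₂ ur ∷ _) ∷ _) = useQR uq ur

  -- A spanning tree built leaf by leaf: each vertex but the root has a `k`-neighbour in the tail
  -- behind it.
  data Connects (k : Colour) : List V → Set where
    root : ∀ x → Connects k (x ∷ [])
    grow : (∃ λ x → x ∈ xs × Edge k x y) → Connects k xs → Connects k (y ∷ xs)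

  attach : ∀ xs → (∀ {y} → y ∈ xs → ∃ λ x → x ∈ ys × Edge k x y) →
    Connects k ys → Connects k (xs ++ ys)
  attach []       f C = C
  attach (x ∷ xs) f C with f (here refl)
  ... | y , y∈ys , e = grow (y , ∈-++⁺ʳ xs y∈ys , e) (attach xs (f ∘ there) C)

  clique-connects : 2 ≤ length R → Clique k R → Connects k R
  clique-connects _ ((xy ∷ []) ∷ _) = grow (_ , here refl , edge-sym xy) (root _)
  clique-connects _ ((xy ∷ _ ∷ _) ∷ K@(_ ∷ _)) =
    grow (_ , here refl , edge-sym xy) (clique-connects (s≤s (s≤s z≤n)) K)
  clique-connects (s≤s ()) ([] ∷ _)

  -- A good vertex misses at most one of two vertices of `R`, so it hangs on the clique.
  good-connects : ∀ us → 2 ≤ length R → Clique k R → All (Good k R) us → Connects k (us ++ R)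
  good-connects {R} {k} us h K gs =
    attach us (λ u∈us → link h (All.lookup gs u∈us)) (clique-connects h K)
    where
    link : 2 ≤ length R → Good k R u → ∃ λ x → x ∈ R × Edge k x u
    link (s≤s ()) ([] ∷ [])
    link _ ((inj₁ up ∷ _) ∷ _) = _ , here refl , edge-sym up
    link _ ((inj₂ uq ∷ _) ∷ _) = _ , there (here refl) , edge-sym uq

  ConnectedPacking : Colour → ℕ → List V → Set
  ConnectedPacking k n xs = ∃₂ λ ys zs → Connects k ys × Packing k n ys × ys ++ zs ↭ xs

  matching : ∀ k n t xs → t ≤ n → 3 * n + t ≤ suc (length xs) →
    ConnectedPacking k n xs ⊎ ∃ λ R → Matching (opp k) t R xs
  matching k n zero    xs t≤n h = inj₂ (xs , none ↭-refl)
  matching k n (suc t) xs t<n h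
    with matching k n t xs (<⇒≤ t<n) (≤-trans (+-monoʳ-≤ (3 * n) (n≤1+n t)) h)
  ... | inj₁ P = inj₁ P
  ... | inj₂ (R , M) with allPairs-or-one (edge? k) R
  ... | inj₂ (x , y , xy , S , σ) =
    inj₂ (S , subst (λ i → Matching (opp k) i S xs) (+-comm t 1)
      (matching-trans M (edge xy (none ↭-refl) σ)))
  ... | inj₁ K with augment-or-good M
  ... | inj₁ M′ = inj₂ M′
  -- The matching has `t` edges, so the clique `R` has at least 3n - t = 3(n - t) + 2t vertices,
  -- which is what `good-packing` asks with n - t = j + 1.
  ... | inj₂ (us , ws , refl , gs , σ) with m≤n⇒∃[o]m+o≡n t<n
  ... | j , refl = inj₁ (us ++ R , ws , good-connects us (2≤clique (length us) j _ h′) K gs ,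
      subst (λ i → Packing k i (us ++ R)) (+-suc (length us) j) (good-packing j us R K gs h′) , σ)
    where
    h′ : 3 * suc j + 2 * length us ≤ length R
    h′ = clique-large (length us) (suc j) (length R)
      (subst (λ i → 3 * (length us + suc j) + suc (length us) ≤ suc i) (matching-length M)
        (subst (λ i → 3 * i + suc (length us) ≤ suc (length xs)) (sym (+-suc (length us) j)) h))

  -- Cuts and complete bipartite connections.

  Complete : Colour → List V → List V → Set
  Complete k A B = ∀ {x y} → x ∈ A → y ∈ B → Edge k x y

  complete-sym : Complete k A B → Complete k B A
  complete-sym f x∈B y∈A = edge-sym (f y∈A x∈B)

  -- `M` lists the matched vertices. The set `S` of apices stays open, to be filled later with
  -- unmatched vertices from across a cut.
  matching-triangles : Matching k m R A → ∃ λ M → M ++ R ↭ A ×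
    (∀ S → Complete k M S → m ≤ length S → Packing k m (M ++ S))
  matching-triangles (none σ) = [] , σ , λ _ _ _ → []
  matching-triangles {k} {suc m} (edge {x = x} {y} e M σ) with matching-triangles M
  ... | N , τ , f = x ∷ y ∷ N , ↭-trans (prep x (prep y τ)) σ , extend
    where
    extend : ∀ S → Complete k (x ∷ y ∷ N) S → suc m ≤ length S → Packing k (suc m) (x ∷ y ∷ N ++ S)
    extend (w ∷ S) g (s≤s h) = perm (prep x (prep y (↭-sym (shift w N S))))
      (triangle (e , g (here refl) (here refl) , g (there (here refl)) (here refl))
        (f S (λ p q → g (there (there p)) (there q)) h))

  -- Edges in `A` take their apices from `S`, edges in `B` from `R`; apices are unmatched, so all
  -- triangles are disjoint.
  matchings-packing : Complete k A B → Matching k s R A → Matching k t S B →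
    s ≤ length S → t ≤ length R → Packing k (s + t) (A ++ B)
  matchings-packing {A = A} {B} {R = R} {S = S} f M N hs ht
    with matching-triangles M | matching-triangles N
  ... | M′ , σ , g | N′ , τ , h = perm
    (↭-trans (permute 4 (λ M R N S → (M ∙ S) ∙ (N ∙ R) ⊜ (M ∙ R) ∙ (N ∙ S)) ↭-refl M′ R N′ S)
      (++⁺ σ τ))
    (packing-++
      (g S (λ p q → f (∈-resp-↭ σ (∈-++⁺ˡ p)) (∈-resp-↭ τ (∈-++⁺ʳ N′ q))) hs)
      (h R (λ p q → edge-sym (f (∈-resp-↭ σ (∈-++⁺ʳ M′ q)) (∈-resp-↭ τ (∈-++⁺ˡ p)))) ht))

  complete-connects : 1 ≤ length A → 1 ≤ length B → Complete k A B →
    ∃ λ ys → Connects k ys × ys ↭ A ++ B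
  complete-connects {a ∷ A} {b ∷ B} _ _ f = A ++ (b ∷ B) ++ a ∷ [] ,
    attach A (λ p → b , here refl , edge-sym (f (there p) (here refl)))
      (attach (b ∷ B) (λ p → a , here refl , f (here refl) p) (root a)) ,
    permute 3 (λ a A B → A ∙ (B ∙ a) ⊜ a ∙ (A ∙ B)) ↭-refl [ a ] A (b ∷ B)

  Cut : Colour → List V → Set
  Cut k xs = ∃₂ λ A B → 1 ≤ length A × 1 ≤ length B × Complete (opp k) A B × A ++ B ↭ xs

  -- The component of the first vertex is grown until no `k`-edge leaves it. In `expand`, `m` bounds
  -- the number of vertices outside and makes the recursion structural.
  connected-or-cut : ∀ k xs → 1 ≤ length xs → (∃ λ ys → Connects k ys × ys ↭ xs) ⊎ Cut k xs
  connected-or-cut k (x ∷ xs) _ =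
    expand (length xs) (x ∷ []) xs ≤-refl (s≤s z≤n) (root x) ↭-refl
    where
    expand : ∀ m ys zs → length zs ≤ m → 1 ≤ length ys → Connects k ys → ys ++ zs ↭ x ∷ xs →
      (∃ λ ys → Connects k ys × ys ↭ x ∷ xs) ⊎ Cut k (x ∷ xs)
    expand m ys [] _ _ C σ = inj₁ (ys , C , ↭-trans (↭-sym (++-identityʳ ys)) σ)
    expand (suc m) ys zs@(_ ∷ zs′) (s≤s h) h′ C σ with all-or-one dec zs
      where
      dec : ∀ z → All (λ y → Edge (opp k) y z) ys ⊎ ∃ λ y → y ∈ ys × Edge k y z
      dec z with all-or-one {P = λ y → Edge (opp k) y z} {Q = λ y → Edge k y z}
        (λ y → [ inj₂ , inj₁ ]′ (edge? k y z)) ys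
      ... | inj₁ avoids = inj₁ avoids
      ... | inj₂ (y , _ , e , τ) = inj₂ (y , ∈-resp-↭ τ (here refl) , e)
    ... | inj₁ avoids = inj₂ (ys , zs , h′ , s≤s z≤n ,
      (λ p q → All.lookup (All.lookup avoids q) p) , σ)
    ... | inj₂ (z , ws , link , τ) = expand m (z ∷ ys) ws
      (subst (_≤ m) (sym (suc-injective (↭-length τ))) h) (s≤s z≤n) (grow link C)
      (↭-trans (↭-sym (shift z ys ws)) (↭-trans (++⁺ˡ ys τ) σ))

  -- Solving the cases of the upper bound.

  Solution : ℕ → List V → Set
  Solution n xs = ∃ λ k → ConnectedPacking k n xs

  solution-resp-↭ : xs ↭ ys → Solution n xs → Solution n ys
  solution-resp-↭ σ (k , ys , zs , C , P , τ) = k , ys , zs , C , P , ↭-trans τ σ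

  solution-++ʳ : ∀ B → ConnectedPacking k n A → Solution n (A ++ B)
  solution-++ʳ B (ys , zs , C , P , σ) =
    _ , ys , zs ++ B , C , P , ↭-trans (↭-reflexive (sym (++-assoc ys zs B))) (++⁺ʳ B σ)

  complete-solution : 1 ≤ length A → 1 ≤ length B → Complete k A B →
    Packing k n (A ++ B) → Solution n (A ++ B)
  complete-solution hA hB f P with complete-connects hA hB f
  ... | ys , C , σ = _ , ys , [] , C , perm (↭-sym σ) P , ↭-trans (++-identityʳ ys) σ

  -- With 4n - 1 vertices, `A` alone supplies all `n` matching edges, and `B` supplies the apices.
  lopsided-cut : 1 ≤ n → Complete (opp k) A B → n ≤ length B → 3 * n + n ≤ suc (length A) →
    1 ≤ length A → Solution n (A ++ B)
  lopsided-cut {n} {k} {A} {B} 1≤n f hB h hA with matching k n n A ≤-refl h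
  ... | inj₁ P = solution-++ʳ B P
  ... | inj₂ (R , M) = complete-solution hA (≤-trans 1≤n hB) f
    (subst (λ i → Packing (opp k) i (A ++ B)) (+-identityʳ n)
      (matchings-packing f M (none ↭-refl) hB z≤n))

  balanced-cut : 1 ≤ n → Complete (opp k) A B → n ≤ length A → n ≤ length B →
    7 * n ≤ 2 + (length A + length B) → Solution n (A ++ B)
  balanced-cut {n} {k} {A} {B} 1≤n f hA hB h
    with 3 * n + n ≤? suc (length A) | 3 * n + n ≤? suc (length B)
  ... | yes p | _     = lopsided-cut {k = k} 1≤n f hB p (≤-trans 1≤n hA)
  ... | no _  | yes p = solution-resp-↭ (++-comm B A)
    (lopsided-cut {k = k} 1≤n (complete-sym f) hA p (≤-trans 1≤n hB))
  -- Now |A| = 3n - 1 + s with s < n. For t = n - s the total of at least 7n - 2 gives |B| ≥ 3n - 1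
  -- + t, so `matching` applies on both sides.
  ... | no ¬p | no ¬q
    with m≤n⇒∃[o]m+o≡n (other-side n (length A) (length B) h (≰⇒> ¬q))
  ... | s , eq
    with m≤n⇒∃[o]m+o≡n (<⇒≤ (+-cancelˡ-< (3 * n) s n (subst (_< 3 * n + n) (sym eq) (≰⇒> ¬p))))
  ... | t , refl = result
    where
    hs : 3 * (s + t) + s ≤ suc (length A)
    hs = ≤-reflexive eq

    ht : 3 * (s + t) + t ≤ suc (length B)
    ht = other-matching s t (length A) (length B) h (≤-reflexive (sym eq))

    result : Solution (s + t) (A ++ B)
    result with matching k (s + t) s A (m≤m+n s t) hs | matching k (s + t) t B (m≤n+m t s) ht
    ... | inj₁ P       | _            = solution-++ʳ B P
    ... | inj₂ _       | inj₁ P       = solution-resp-↭ (++-comm B A) (solution-++ʳ A P)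
    ... | inj₂ (R , M) | inj₂ (S , N) = complete-solution (≤-trans 1≤n hA) (≤-trans 1≤n hB) f
      (matchings-packing f M N
        (matching-leftover t s (length S) (subst (1 ≤_) (+-comm s t) 1≤n)
          (subst (λ i → 3 * i + t ≤ suc (2 * t + length S)) (+-comm s t)
            (subst (λ i → 3 * (s + t) + t ≤ suc i) (matching-length N) ht)))
        (matching-leftover s t (length R) 1≤n
          (subst (λ i → 3 * (s + t) + s ≤ suc i) (matching-length M) hs)))

  -- If `A` is `k`-connected, a packing in `A` is connected in either colour: through `A` itself or
  -- through the complete cut to `B`. If `A` splits, its smaller part may join `B`, and the bound
  -- `d` on |A| decreases.
  giant-side : ∀ d → length A ≤ d → 2 ≤ n → 1 ≤ length B → Complete (opp k) A B →
    6 * n ≤ suc (length A) → 7 * n ≤ 2 + (length A + length B) → Solution n (A ++ B)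
  giant-side {A} {n@(suc n′)} {B} {k} d hd 2≤n hB f h h′
    with connected-or-cut k A (nonempty n′ _ h)
  ... | inj₁ (ys , C , σ) = connected
    where
    connected : Solution n (A ++ B)
    connected with mono-packing n A 2≤n h
    ... | l , P with same-or-opp k l
    ... | inj₁ refl = solution-++ʳ {k = k} B
      (ys , [] , C , perm (↭-sym σ) P , ↭-trans (++-identityʳ ys) σ)
    ... | inj₂ refl = complete-solution (nonempty n′ _ h) hB f (packing-++ʳ B P)
  giant-side {A} {n@(suc n′)} {B} {k} zero hd 2≤n hB f h h′ | inj₂ _
    with () ← ≤-trans (nonempty n′ _ h) hd
  giant-side {A} {n@(suc n′)} {B} {k} (suc d) hd 2≤n hB f h h′
    | inj₂ (C , D , hC , hD , g , σ) = cut
    where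
    descend : ∀ C D → 1 ≤ length D → Complete (opp k) C D → C ++ D ↭ A → n ≤ length C →
      Solution n (A ++ B)
    descend C D hD g σ hn = solution-resp-↭ τ split
      where
      τ : C ++ D ++ B ↭ A ++ B
      τ = ↭-trans (↭-reflexive (sym (++-assoc C D B))) (++⁺ʳ B σ)

      f′ : Complete (opp k) C (D ++ B)
      f′ x∈C y∈ with ∈-++⁻ D y∈
      ... | inj₁ y∈D = g x∈C y∈D
      ... | inj₂ y∈B = f (∈-resp-↭ σ (∈-++⁺ˡ x∈C)) y∈B

      len : length A + length B ≡ length C + length (D ++ B)
      len = trans (sym (length-++ A)) (trans (sym (↭-length τ)) (length-++ C))

      7n≤ : 7 * n ≤ 2 + (length C + length (D ++ B))
      7n≤ = subst (λ i → 7 * n ≤ 2 + i) len h′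

      C<A : suc (length C) ≤ length A
      C<A = ≤-trans (≤-reflexive (+-comm 1 (length C))) (≤-trans (+-monoʳ-≤ (length C) hD)
        (≤-reflexive (trans (sym (length-++ C)) (↭-length σ))))

      split : Solution n (C ++ D ++ B)
      split with n ≤? length (D ++ B)
      ... | yes p = balanced-cut {k = k} (s≤s z≤n) f′ hn p 7n≤
      ... | no ¬p = giant-side {k = k} d (≤-pred (≤-trans C<A hd)) 2≤n
        (≤-trans hD (≤-trans (m≤m+n _ _) (≤-reflexive (sym (length-++ D))))) f′
        (small-side n (length C) (length (D ++ B)) 7n≤ (≰⇒> ¬p)) 7n≤

    cut : Solution n (A ++ B)
    cut with n ≤? length C
    ... | yes p = descend C D hD g σ p
    -- Since |C| + |D| ≥ 6n - 1, one of the two parts has at least `n` vertices; that part is kept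
    -- and the other joins `B`.
    ... | no ¬p = descend D C hC (complete-sym g) (↭-trans (++-comm D C) σ)
      (large-part n′ (length C) (length D)
        (subst (λ i → 6 * n ≤ suc i) (trans (sym (↭-length σ)) (length-++ C)) h) (≰⇒> ¬p))

  cut-solution : 2 ≤ n → 7 * n ≤ 2 + length xs → Cut k xs → Solution n xs
  cut-solution {n} {k = k} 2≤n h (A , B , hA , hB , f , σ) = result
    where
    size : ∀ A B → A ++ B ↭ _ → 7 * n ≤ 2 + (length A + length B)
    size A B σ = subst (λ i → 7 * n ≤ 2 + i) (trans (sym (↭-length σ)) (length-++ A)) h

    τ : B ++ A ↭ _
    τ = ↭-trans (++-comm B A) σ

    result : Solution n _
    result with n ≤? length A | n ≤? length B
    ... | yes p | yes q = solution-resp-↭ σ (balanced-cut {k = k} (<⇒≤ 2≤n) f p q (size A B σ))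
    ... | _     | no ¬q = solution-resp-↭ σ (giant-side {k = k} _ ≤-refl 2≤n hB f
      (small-side n (length A) (length B) (size A B σ) (≰⇒> ¬q)) (size A B σ))
    ... | no ¬p | yes _ = solution-resp-↭ τ (giant-side {k = k} _ ≤-refl 2≤n hA (complete-sym f)
      (small-side n (length B) (length A) (size B A τ) (≰⇒> ¬p)) (size B A τ))

  solution : 2 ≤ n → ∀ xs → 7 * n ≤ 2 + length xs → Solution n xs
  solution {n@(suc n′)} 2≤n xs h with six≤seven n (length xs) 2≤n h
  ... | h₆ with connected-or-cut red xs (nonempty n′ _ h₆) | connected-or-cut blue xs (nonempty n′ _ h₆)
  ... | inj₂ cut | _ = cut-solution {k = red} 2≤n h cut
  ... | _ | inj₂ cut = cut-solution {k = blue} 2≤n h cut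
  ... | inj₁ (ys , C , σ) | inj₁ (zs , D , τ) with mono-packing n xs 2≤n h₆
  ... | red  , P = red , ys , [] , C , perm (↭-sym σ) P , ↭-trans (++-identityʳ ys) σ
  ... | blue , P = blue , zs , [] , D , perm (↭-sym τ) P , ↭-trans (++-identityʳ zs) τ

-- From vertex lists to subgraphs.

module _ {A : Set} where

  unique-resp-↭ : {xs ys : List A} → xs ↭ ys → Unique xs → Unique ys
  unique-resp-↭ σ = Permutation.Unique-resp-↭ (setoid A) (↭⇒↭ₛ σ)

  unique-++⁻ : ∀ xs {ys : List A} → Unique (xs ++ ys) →
    Unique xs × Unique ys × (∀ {x y} → x ∈ xs → y ∈ ys → x ≢ y)
  unique-++⁻ []       u       = [] , u , λ ()
  unique-++⁻ (x ∷ xs) (p ∷ u) with unique-++⁻ xs u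
  ... | u₁ , u₂ , disjoint = All.++⁻ˡ xs p ∷ u₁ , u₂ , λ where
    (here refl)  y∈ys → All.lookup (All.++⁻ʳ xs p) y∈ys
    (there x∈xs) y∈ys → disjoint x∈xs y∈ys

  lookup-injective : {xs : List A} → Unique xs → Injective _≡_ _≡_ (lookup xs)
  lookup-injective (p ∷ u) {zero}  {zero}  eq = refl
  lookup-injective (p ∷ u) {zero}  {suc j} eq = contradiction eq (All.lookup p (∈-lookup j))
  lookup-injective (p ∷ u) {suc i} {zero}  eq = contradiction (sym eq) (All.lookup p (∈-lookup i))
  lookup-injective (p ∷ u) {suc i} {suc j} eq = cong suc (lookup-injective u eq)

-- Vertices are positions in the list; for a list without repetitions they correspond to its
-- entries.
induced : (G : Graph) → List (V G) → Graph
induced G xs = record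
  { V     = Fin (length xs)
  ; _~_   = λ i j → lookup xs i G.~ lookup xs j
  ; ~-sym = G.~-sym
  ; ~-irr = λ i≡j → G.~-irr (cong (lookup xs) i≡j)
  }
  where module G = Graph G

module Extraction {N} (χ : EdgeColouring (K N)) where

  open EdgeColouring χ
  open Colouring colour colour-sym

  packing-triangles : ∀ {k n xs} → Unique xs → Packing k n xs → Σ (Fin n × Fin 3 → Fin N) λ f →
    (∀ u → f u ∈ xs) × Injective _≡_ _≡_ f ×
    (∀ i {a b} → a ≢ b → colour (f (i , a)) (f (i , b)) ≡ k)
  packing-triangles u [] = (λ ()) , (λ ()) , (λ { {()} }) , λ ()
  packing-triangles u (perm σ P) with packing-triangles (unique-resp-↭ (↭-sym σ) u) P
  ... | f , mem , inj , adj = f , ∈-resp-↭ σ ∘ mem , inj , adj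
  packing-triangles {k} {suc n} u (triangle {x = x} {y} {z} {xs = xs} (xy , xz , yz) P)
    with unique-++⁻ (x ∷ y ∷ z ∷ []) u
  ... | u₁ , u₂ , disjoint with packing-triangles u₂ P
  ... | f , mem , inj , adj = g , g-mem , g-inj , g-adj
    where
    g : Fin (suc n) × Fin 3 → Fin N
    g (zero  , a) = lookup (x ∷ y ∷ z ∷ []) a
    g (suc i , a) = f (i , a)

    g-mem : ∀ u → g u ∈ x ∷ y ∷ z ∷ xs
    g-mem (zero  , a) = ∈-++⁺ˡ (∈-lookup {xs = x ∷ y ∷ z ∷ []} a)
    g-mem (suc i , a) = there (there (there (mem (i , a))))

    g-inj : Injective _≡_ _≡_ g
    g-inj {zero  , a} {zero  , b} eq = cong (zero ,_) (lookup-injective u₁ eq)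
    g-inj {zero  , a} {suc j , b} eq = contradiction eq (disjoint (∈-lookup a) (mem (j , b)))
    g-inj {suc i , a} {zero  , b} eq = contradiction (sym eq) (disjoint (∈-lookup b) (mem (i , a)))
    g-inj {suc i , a} {suc j , b} eq with refl ← inj eq = refl

    g-adj : ∀ i {a b} → a ≢ b → colour (g (i , a)) (g (i , b)) ≡ k
    g-adj (suc i)        a≢b = adj i a≢b
    g-adj zero {0F} {0F} a≢b = contradiction refl a≢b
    g-adj zero {0F} {1F} a≢b = xy
    g-adj zero {0F} {2F} a≢b = xz
    g-adj zero {1F} {0F} a≢b = edge-sym xy
    g-adj zero {1F} {1F} a≢b = contradiction refl a≢b
    g-adj zero {1F} {2F} a≢b = yz
    g-adj zero {2F} {0F} a≢b = edge-sym xz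
    g-adj zero {2F} {1F} a≢b = edge-sym yz
    g-adj zero {2F} {2F} a≢b = contradiction refl a≢b

  Path : ∀ k xs → Fin (length xs) → Fin (length xs) → Set
  Path k xs = Star (Graph._~_ (induced (class χ k) xs))

  connects-paths : ∀ {k xs} → Unique xs → Connects k xs → ∀ i j → Path k xs i j
  connects-paths u (root x) zero zero = ε
  connects-paths {k} (p ∷ u) (grow {xs = xs} {y = y} (x , x∈xs , e) C) = path
    where
    module H = Graph (induced (class χ k) (y ∷ xs))

    from-y : ∀ j → Path k (y ∷ xs) zero (suc j)
    from-y j = subst (λ w → y ≢ w × colour y w ≡ k) (lookup-index x∈xs)
        (All.lookup p x∈xs , edge-sym e)
      ◅ gmap suc id (connects-paths u C (index x∈xs) j)

    path : ∀ i j → Path k (y ∷ xs) i j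
    path zero    zero    = ε
    path zero    (suc j) = from-y j
    path (suc i) zero    = reverse (λ {v} {w} → H.~-sym {v} {w}) (from-y i)
    path (suc i) (suc j) = gmap suc id (connects-paths u C i j)

  contains : ∀ {k n xs} → 1 ≤ n → Unique xs → ConnectedPacking k n xs →
    Contains (class χ k) c[ n K₃]
  contains {k} {suc n} _ u (ys , zs , C , P , σ) with unique-++⁻ ys (unique-resp-↭ (↭-sym σ) u)
  ... | u₁ , _ , _ with packing-triangles u₁ P
  -- `Connected` asks for a vertex, here a corner of the first triangle.
  ... | f , mem , inj , adj = H , ((g (zero , zero) , connects-paths u₁ C) , nK₃⊑H) , H⊑χ
    where
    H : Graph
    H = induced (class χ k) ys

    g : Fin (suc n) × Fin 3 → Fin (length ys)
    g v = index (mem v)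

    lookup-g : ∀ v → lookup ys (g v) ≡ f v
    lookup-g v = sym (lookup-index (mem v))

    nK₃⊑H : (suc n K₃) ⊑ H
    nK₃⊑H = record
      { map       = g
      ; injective = λ {v} {w} eq → inj (trans (sym (lookup-g v))
          (trans (cong (lookup ys) eq) (lookup-g w)))
      ; preserves = λ { {i , a} {.i , b} (refl , a≢b) →
          (λ eq → a≢b (cong proj₂ (inj (trans (sym (lookup-g (i , a))) (trans eq (lookup-g (i , b))))))) ,
          trans (cong₂ colour (lookup-g (i , a)) (lookup-g (i , b))) (adj i a≢b) }
      }

    H⊑χ : H ⊑ class χ k
    H⊑χ = record { map = lookup ys ; injective = lookup-injective u₁ ; preserves = id }

upper-bound : ∀ n → 2 ≤ n → ∀ N → 7 * n ≤ 2 + N → N ⟶[ c[ n K₃] , c[ n K₃] ]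
upper-bound n 2≤n N h χ with solution 2≤n (allFin N)
    (subst (λ i → 7 * n ≤ 2 + i) (sym (length-tabulate {n = N} id)) h)
  where
  open EdgeColouring χ
  open Colouring colour colour-sym
... | red  , P = inj₁ (Extraction.contains χ (<⇒≤ 2≤n) (allFin⁺ N) P)
... | blue , P = inj₂ (Extraction.contains χ (<⇒≤ 2≤n) (allFin⁺ N) P)

-- The extremal colouring and the lower bound.

interval-injection⇒≤ : ∀ {k} o s (f : Fin k → ℕ) → Injective _≡_ _≡_ f →
  (∀ i → o ≤ f i × f i < o + s) → k ≤ s
interval-injection⇒≤ {k} o s f inj within = Fin.injective⇒≤ {f = g} g-inj
  where
  lt : ∀ i → f i ∸ o < s
  lt i = +-cancelˡ-< o (f i ∸ o) s
    (subst (_< o + s) (sym (m+[n∸m]≡n (proj₁ (within i)))) (proj₂ (within i)))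

  g : Fin k → Fin s
  g i = fromℕ< (lt i)

  g-inj : Injective _≡_ _≡_ g
  g-inj {i} {j} eq = inj (∸-cancelʳ-≡ (proj₁ (within i)) (proj₁ (within j))
    (Fin.fromℕ<-injective _ _ (lt i) (lt j) eq))

data Part : Set where
  A B C : Part

part-colour : Part → Part → Colour
part-colour A A = red
part-colour B B = red
part-colour C C = red
part-colour _ _ = blue

part-colour-sym : ∀ p q → part-colour p q ≡ part-colour q p
part-colour-sym A A = refl
part-colour-sym A B = refl
part-colour-sym A C = refl
part-colour-sym B A = refl
part-colour-sym B B = refl
part-colour-sym B C = refl
part-colour-sym C A = refl
part-colour-sym C B = refl
part-colour-sym C C = refl

red⇒≡ : ∀ p q → part-colour p q ≡ red → p ≡ q
red⇒≡ A A _ = refl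
red⇒≡ B B _ = refl
red⇒≡ C C _ = refl

-- Blue edges join different blocks, so the three corners occupy all three blocks.
blue-triangle-meets-C : (p : Fin 3 → Part) →
  (∀ {a b} → a ≢ b → part-colour (p a) (p b) ≡ blue) →
  ∃ λ a → p a ≡ C
blue-triangle-meets-C p e
  with p 0F in eq₀ | p 1F in eq₁ | p 2F in eq₂
     | e {0F} {1F} (λ ()) | e {0F} {2F} (λ ()) | e {1F} {2F} (λ ())
... | C | _ | _ | _ | _ | _ = 0F , eq₀
... | _ | C | _ | _ | _ | _ = 1F , eq₁
... | _ | _ | C | _ | _ | _ = 2F , eq₂
... | A | A | _ | () | _ | _
... | B | B | _ | () | _ | _
... | A | B | A | _ | () | _
... | B | A | B | _ | () | _
... | A | B | B | _ | _ | ()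
... | B | A | A | _ | _ | ()

-- Here n = m + 1. For smaller `M` the last blocks are cut short, so `size` is only an upper bound
-- on a block.
module LowerBound (m M : ℕ) (M≤ : M ≤ 2 + 3 * m + (2 + 3 * m) + m) where

  offset size : Part → ℕ
  offset A = 0
  offset B = 2 + 3 * m
  offset C = 2 + 3 * m + (2 + 3 * m)
  size A = 2 + 3 * m
  size B = 2 + 3 * m
  size C = m

  part : ℕ → Part
  part i with i <? offset B | i <? offset C
  ... | yes _ | _     = A
  ... | no  _ | yes _ = B
  ... | no  _ | no  _ = C

  part-bounds : ∀ i → i < M → offset (part i) ≤ i × i < offset (part i) + size (part i)
  part-bounds i i<M with i <? offset B | i <? offset C
  ... | yes p | _     = z≤n , p
  ... | no ¬p | yes q = ≮⇒≥ ¬p , q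
  ... | no _  | no ¬q = ≮⇒≥ ¬q , <-≤-trans i<M M≤

  size≤ : ∀ p → size p ≤ 2 + 3 * m
  size≤ A = ≤-refl
  size≤ B = ≤-refl
  size≤ C = m≤2+3m m

  partᶠ : Fin M → Part
  partᶠ = part ∘ toℕ

  χ : EdgeColouring (K M)
  χ = record
    { colour     = λ u v → part-colour (partᶠ u) (partᶠ v)
    ; colour-sym = λ u v → part-colour-sym (partᶠ u) (partᶠ v)
    }

  part-injection⇒≤ : ∀ {k} p (f : Fin k → Fin M) → Injective _≡_ _≡_ f →
    (∀ i → partᶠ (f i) ≡ p) → k ≤ size p
  part-injection⇒≤ p f inj f∈p =
    interval-injection⇒≤ (offset p) (size p) (toℕ ∘ f)
      (inj ∘ Fin.toℕ-injective)
      (λ i → subst (λ q → offset q ≤ toℕ (f i) × toℕ (f i) < offset q + size q) (f∈p i)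
        (part-bounds (toℕ (f i)) (Fin.toℕ<n (f i))))

  -- Red paths stay inside one block, which has at most 3n - 1 vertices, too few for `n` disjoint
  -- triangles.
  no-red : ¬ Contains (class χ red) c[ suc m K₃]
  no-red (H , ((h₀ , connected) , nK₃⊑H) , H⊑χ) = contradiction
    (large-block m (size p) (size≤ p) (part-injection⇒≤ p (H⊑χ.map ∘ g ∘ remQuot 3)
      (remQuot-injective ∘ nK₃⊑H.injective ∘ H⊑χ.injective)
      (λ i → sym (same-part (connected h₀ (g (remQuot 3 i)))))))
    λ ()
    where
    module H = Graph H
    module nK₃⊑H = _⊑_ nK₃⊑H
    module H⊑χ = _⊑_ H⊑χ
    g = nK₃⊑H.map
    p = partᶠ (H⊑χ.map h₀)

    same-part : ∀ {u v} → Star H._~_ u v → partᶠ (H⊑χ.map u) ≡ partᶠ (H⊑χ.map v)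
    same-part ε        = refl
    same-part (e ◅ es) = trans (red⇒≡ _ _ (proj₂ (H⊑χ.preserves e))) (same-part es)

    remQuot-injective : Injective _≡_ _≡_ (remQuot {suc m} 3)
    remQuot-injective {i} {j} eq = trans (sym (Fin.combine-remQuot {suc m} 3 i))
      (trans (cong (uncurry combine) eq) (Fin.combine-remQuot {suc m} 3 j))

  -- Each of the `n` disjoint triangles would need its own vertex in block `C`, which has at most n
  -- - 1.
  no-blue : ¬ Contains (class χ blue) c[ suc m K₃]
  no-blue (H , (_ , nK₃⊑H) , H⊑χ) = <-irrefl refl
    (part-injection⇒≤ C (λ i → f (i , corner i)) (cong proj₁ ∘ nK₃⊑H.injective ∘ H⊑χ.injective)
      (λ i → proj₂ (meets i)))
    where
    module nK₃⊑H = _⊑_ nK₃⊑H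
    module H⊑χ = _⊑_ H⊑χ

    f : Fin (suc m) × Fin 3 → Fin M
    f = H⊑χ.map ∘ nK₃⊑H.map

    meets : ∀ i → ∃ λ a → partᶠ (f (i , a)) ≡ C
    meets i = blue-triangle-meets-C (λ a → partᶠ (f (i , a)))
      (λ a≢b → proj₂ (H⊑χ.preserves (nK₃⊑H.preserves (refl , a≢b))))

    corner : Fin (suc m) → Fin 3
    corner i = proj₁ (meets i)

lower-bound : ∀ m M → M ⟶[ c[ suc m K₃] , c[ suc m K₃] ] → 7 * suc m ∸ 2 ≤ M
lower-bound m M arrows with 7 * suc m ∸ 2 ≤? M
... | yes p = p
... | no ¬p = contradiction (arrows χ) [ no-red , no-blue ]′
  where open LowerBound m M (three-blocks m M (≰⇒> ¬p))

theorem1 : ∀ (n : ℕ) → 2 ≤ n → R⟨ c[ n K₃] , c[ n K₃] ⟩≡ (7 * n ∸ 2)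
theorem1 n@(suc m) 2≤n = record
  { positive = m<n⇒0<n∸m (2<7n m)
  ; arrows   = upper-bound n 2≤n (7 * n ∸ 2) (m≤n+m∸n (7 * n) 2)
  ; least    = λ M _ → lower-bound m M
  }
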